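{- If $n\ge 6$ is an even integer, then $$\chi(Q_{n}^{[\natural n-4]}) \le \min\{2\chi(J(n,(n-4)/2,0))+\chi(J(n,n/2,2)),\ 2\chi(J(n,(n-2)/2,1))+2 \} \le 2\chi(K(8,3,1))+2.$$
   Context: $Q_n^{[\natural p]}$ is the graph on $\{0,1\}^n$ in which two vertices are adjacent iff they differ in exactly $p$ coordinates. For integers $i\le k\le n$, the generalized Johnson graph $J(n,k,i)$ has vertex set $\{A\subseteq\{1,\ldots,n\}: |A|=k\}$ and edge set $\{AB: |A\cap B|=i\}$; the generalized Kneser graph $K(n,k,i)$ has the same vertex set, two distinct vertices $A,B$ being adjacent iff $|A\cap B|\le i$. $\chi$ denotes the chromatic number. -}

module Defs where

open import Data.Nat using (ℕ; zero; suc; _+_; _≤_)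
open import Data.Bool using (Bool; true; false)
open import Data.Vec using (Vec; []; _∷_)
open import Data.Fin using (Fin)
open import Data.Fin.Subset using (Subset; ∣_∣; _∩_)
open import Data.Product using (Σ; _×_; proj₁)
open import Relation.Binary.PropositionalEquality using (_≡_)
open import Relation.Nullary using (¬_)

record Graph : Set₁ where
  field
    V   : Set
    Adj : V → V → Set

open Graph public

Colorable : Graph → ℕ → Set
Colorable G k = Σ (V G → Fin k) λ c → ∀ u v → Adj G u v → ¬ (c u ≡ c v)

IsChromaticNumber : Graph → ℕ → Set
IsChromaticNumber G k = Colorable G k × (∀ m → Colorable G m → k ≤ m)

differ : Bool → Bool → ℕ
differ true  true  = 0
differ false false = 0
differ true  false = 1
differ false true  = 1

hamming : ∀ {n} → Vec Bool n → Vec Bool n → ℕ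
hamming []       []       = 0
hamming (x ∷ xs) (y ∷ ys) = differ x y + hamming xs ys

Qexact : ℕ → ℕ → Graph
Qexact n p = record { V = Vec Bool n ; Adj = λ x y → hamming x y ≡ p }

KSubset : ℕ → ℕ → Set
KSubset n k = Σ (Subset n) λ A → ∣ A ∣ ≡ k

Johnson : ℕ → ℕ → ℕ → Graph
Johnson n k i = record
  { V = KSubset n k
  ; Adj = λ A B → ∣ proj₁ A ∩ proj₁ B ∣ ≡ i }

Kneser : ℕ → ℕ → ℕ → Graph
Kneser n k i = record
  { V = KSubset n k
  ; Adj = λ A B → ¬ (proj₁ A ≡ proj₁ B) × (∣ proj₁ A ∩ proj₁ B ∣ ≤ i) }

{-# OPTIONS --safe #-}
-- Put n = 2k + 4, so that adjacent vertices x, y of the cube graph satisfy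
-- |x| + |y| = 2k + 2|x ∩ y|.  Adjacent vertices have weights of the same
-- parity, and flipping a coordinate exchanges the two parity classes, so it
-- suffices to colour either one.
--   * Weights ≡ k: edges between weights ≤ k are exactly those of J(n, k, 0)
--     on weight k; complements of weight ≤ k behave alike; the only other
--     weight is k + 2, which carries J(n, k + 2, 2).
--   * Weights ≡ k + 1: the weights < k are independent, weight k + 1 carries
--     J(n, k + 1, 1), and the remaining vertices are complements of these.
-- The second inequality follows from χ(J(n, k + 1, 1)) ≤ χ(K(8, 3, 1)).  For
-- n ≥ 8, iterate Stahl's homomorphism K(n + 2, k + 1, i) → K(n, k, i).  For
-- n = 6, a proper 7-edge-colouring of K₆ followed by the lines of the Fano
-- plane is a homomorphism J(6, 2, 1) → K(8, 3, 1).
module Submission where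

open import Defs
open import Data.Bool using (Bool; true; false; not; _xor_)
open import Data.Fin using (Fin; zero; join; splitAt)
open import Data.Fin.Properties using (splitAt-join)
open import Data.Fin.Subset using (Subset; ∣_∣; _∩_; ∁)
open import Data.Fin.Subset.Properties using (∩-comm; ∩-idem; ∣∁p∣≡n∸∣p∣; ∣p∣≤n)
open import Data.Nat using (ℕ; zero; suc; _+_; _*_; _∸_; _≤_; _<_; z≤n; s≤s; s≤s⁻¹; _≤?_; _⊓_; _/_; _%_; parity)
open import Data.Nat.Divisibility using (divides-refl; m%n≡0⇒n∣m)
open import Data.Nat.DivMod using (m*n/n≡m)
open import Data.Nat.Properties
open import Data.Nat.Tactic.RingSolver using (solve-∀)
open import Data.Parity using (0ℙ; 1ℙ; _⁻¹)
import Data.Parity as ℙ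
import Data.Parity.Properties as ℙ
open import Data.Product using (Σ; _×_; _,_; proj₁)
open import Data.Sum using (_⊎_; inj₁; inj₂)
open import Data.Sum.Properties using (inj₁-injective; inj₂-injective)
open import Data.Vec using (Vec; []; _∷_; map)
open import Function using (_∘_; id)
open import Relation.Binary.PropositionalEquality using (_≡_; refl; sym; trans; cong; cong₂; subst; subst₂; module ≡-Reasoning)
open import Relation.Nullary using (¬_; Dec; yes; no; contradiction; map′)
open import Relation.Nullary.Decidable using (_×-dec_; _→-dec_; from-yes)
open import Relation.Unary using (Decidable)

private
  variable
    n k i a b c : ℕ
    G H K : Graph

-- Homomorphisms and induced subgraphs

record _⟶_ (G H : Graph) : Set where
  constructor hom
  field
    ⟦_⟧      : V G → V H
    preserve : ∀ u v → Adj G u v → Adj H (⟦_⟧ u) (⟦_⟧ v)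

infixr 9 _⊚_
_⊚_ : H ⟶ K → G ⟶ H → G ⟶ K
hom g q ⊚ hom f p = hom (g ∘ f) (λ u v → q (f u) (f v) ∘ p u v)

pullback : G ⟶ H → Colorable H k → Colorable G k
pullback (hom f p) (col , proper) = col ∘ f , λ u v → proper (f u) (f v) ∘ p u v

Induced : (G : Graph) → (V G → Set) → Graph
Induced G P = record { V = Σ (V G) P ; Adj = λ u v → Adj G (proj₁ u) (proj₁ v) }

-- `join` keeps the two palettes disjoint, so edges between the parts need no care; where P and Q
-- overlap, the covering map chooses.
colorable-∪ : {P Q R : V G → Set} → (∀ v → R v → P v ⊎ Q v) →
  Colorable (Induced G P) a → Colorable (Induced G Q) b → Colorable (Induced G R) (a + b)
colorable-∪ {G} {a} {b} {P} {Q} R⊆P∪Q (f , f-proper) (g , g-proper) =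
  (λ (v , r) → join a b (side (R⊆P∪Q v r))) ,
  λ (u , r) (v , s) uv → side-proper u v uv (R⊆P∪Q u r) (R⊆P∪Q v s) ∘ join-injective
  where
  side : ∀ {v} → P v ⊎ Q v → Fin a ⊎ Fin b
  side {v} (inj₁ p) = inj₁ (f (v , p))
  side {v} (inj₂ q) = inj₂ (g (v , q))

  join-injective : ∀ {x y} → join a b x ≡ join a b y → x ≡ y
  join-injective {x} {y} eq =
    trans (sym (splitAt-join a b x)) (trans (cong (splitAt a) eq) (splitAt-join a b y))

  side-proper : ∀ u v → Adj G u v → ∀ x y → ¬ side {u} x ≡ side {v} y
  side-proper u v uv (inj₁ p) (inj₁ q) = f-proper (u , p) (v , q) uv ∘ inj₁-injective
  side-proper u v uv (inj₂ p) (inj₂ q) = g-proper (u , p) (v , q) uv ∘ inj₂-injective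
  side-proper u v uv (inj₁ _) (inj₂ _) ()
  side-proper u v uv (inj₂ _) (inj₁ _) ()

colorable-edgeless : (∀ u v → ¬ Adj G u v) → Colorable G 1
colorable-edgeless edgeless = (λ _ → zero) , λ u v uv _ → edgeless u v uv

-- Hamming distance, weight and parity

-- The sum |x| + |y| counts a common element twice and a differing coordinate once.
hamming-∩ : (x y : Vec Bool n) → hamming x y + ∣ x ∩ y ∣ * 2 ≡ ∣ x ∣ + ∣ y ∣
hamming-∩ []          []          = refl
hamming-∩ (false ∷ x) (false ∷ y) = hamming-∩ x y
hamming-∩ (true ∷ x)  (false ∷ y) = cong suc (hamming-∩ x y)
hamming-∩ (false ∷ x) (true ∷ y)  = trans (cong suc (hamming-∩ x y)) (sym (+-suc ∣ x ∣ ∣ y ∣))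
hamming-∩ (true ∷ x)  (true ∷ y)  = begin
  hamming x y + (2 + ∣ x ∩ y ∣ * 2) ≡⟨ shift (hamming x y) _ ⟩
  2 + (hamming x y + ∣ x ∩ y ∣ * 2) ≡⟨ cong (2 +_) (hamming-∩ x y) ⟩
  2 + (∣ x ∣ + ∣ y ∣)               ≡⟨ cong suc (sym (+-suc ∣ x ∣ ∣ y ∣)) ⟩
  suc ∣ x ∣ + suc ∣ y ∣             ∎
  where
  open ≡-Reasoning
  shift : ∀ h j → h + (2 + j) ≡ 2 + (h + j)
  shift = solve-∀

hamming-∁ : (x y : Vec Bool n) → hamming (∁ x) (∁ y) ≡ hamming x y
hamming-∁ []          []          = refl
hamming-∁ (true ∷ x)  (true ∷ y)  = hamming-∁ x y
hamming-∁ (true ∷ x)  (false ∷ y) = cong suc (hamming-∁ x y)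
hamming-∁ (false ∷ x) (true ∷ y)  = cong suc (hamming-∁ x y)
hamming-∁ (false ∷ x) (false ∷ y) = hamming-∁ x y

∣p∣+∣∁p∣≡n : (x : Subset n) → ∣ x ∣ + ∣ ∁ x ∣ ≡ n
∣p∣+∣∁p∣≡n x = trans (cong (∣ x ∣ +_) (∣∁p∣≡n∸∣p∣ x)) (m+[n∸m]≡n (∣p∣≤n x))

parity-double : ∀ k → parity (k * 2) ≡ 0ℙ
parity-double k = trans (ℙ.*-homo-* k 2) (ℙ.*-zeroʳ (parity k))

parity-suc-≢ : ∀ m → ¬ parity (suc m) ≡ parity m
parity-suc-≢ m eq = ℙ.p≢p⁻¹ (parity (suc m)) (trans eq (sym (ℙ.suc-homo-⁻¹ m)))

p+q≡0ℙ⇒p≡q : ∀ p q → p ℙ.+ q ≡ 0ℙ → p ≡ q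
p+q≡0ℙ⇒p≡q 0ℙ 0ℙ _ = refl
p+q≡0ℙ⇒p≡q 1ℙ 1ℙ _ = refl

hamming-even⇒parity-≡ : (x y : Vec Bool n) → hamming x y ≡ k * 2 → parity ∣ x ∣ ≡ parity ∣ y ∣
hamming-even⇒parity-≡ {k = k} x y eq = p+q≡0ℙ⇒p≡q _ _ (begin
  parity ∣ x ∣ ℙ.+ parity ∣ y ∣             ≡⟨ sym (ℙ.+-homo-+ ∣ x ∣ ∣ y ∣) ⟩
  parity (∣ x ∣ + ∣ y ∣)                    ≡⟨ cong parity (sym (hamming-∩ x y)) ⟩
  parity (hamming x y + ∣ x ∩ y ∣ * 2)      ≡⟨ cong (λ h → parity (h + ∣ x ∩ y ∣ * 2)) eq ⟩
  parity (k * 2 + ∣ x ∩ y ∣ * 2)            ≡⟨ cong parity (sym (*-distribʳ-+ 2 k ∣ x ∩ y ∣)) ⟩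
  parity ((k + ∣ x ∩ y ∣) * 2)              ≡⟨ parity-double (k + ∣ x ∩ y ∣) ⟩
  0ℙ                                        ∎)
  where open ≡-Reasoning

flip : Vec Bool (suc n) → Vec Bool (suc n)
flip (b ∷ x) = not b ∷ x

hamming-flip : (x y : Vec Bool (suc n)) → hamming (flip x) (flip y) ≡ hamming x y
hamming-flip (true ∷ x)  (true ∷ y)  = refl
hamming-flip (true ∷ x)  (false ∷ y) = refl
hamming-flip (false ∷ x) (true ∷ y)  = refl
hamming-flip (false ∷ x) (false ∷ y) = refl

parity-flip : (x : Vec Bool (suc n)) → parity ∣ flip x ∣ ≡ parity ∣ x ∣ ⁻¹
parity-flip (false ∷ x) = sym (ℙ.⁻¹-selfInverse (ℙ.suc-homo-⁻¹ ∣ x ∣))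
parity-flip (true ∷ x)  = sym (ℙ.suc-homo-⁻¹ ∣ x ∣)

p≢q⇒p⁻¹≡q : ∀ p q → ¬ p ≡ q → p ⁻¹ ≡ q
p≢q⇒p⁻¹≡q 0ℙ 0ℙ p≢q = contradiction refl p≢q
p≢q⇒p⁻¹≡q 0ℙ 1ℙ _   = refl
p≢q⇒p⁻¹≡q 1ℙ 0ℙ _   = refl
p≢q⇒p⁻¹≡q 1ℙ 1ℙ p≢q = contradiction refl p≢q

-- The distance is even, so the ends of an edge have equal parity: both are flipped or neither is,
-- and either way the distance is kept.
Qexact-parity : ∀ π → Qexact (suc n) (k * 2) ⟶ Induced (Qexact (suc n) (k * 2)) (λ x → parity ∣ x ∣ ≡ π)
Qexact-parity {n} {k} π = hom (λ x → normalise x (parity ∣ x ∣ ℙ.≟ π))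
  λ x y xy → adj x y xy (parity ∣ x ∣ ℙ.≟ π) (parity ∣ y ∣ ℙ.≟ π)
  where
  normalise : (x : Vec Bool (suc n)) → Dec (parity ∣ x ∣ ≡ π) → Σ (Vec Bool (suc n)) (λ x → parity ∣ x ∣ ≡ π)
  normalise x (yes eq) = x , eq
  normalise x (no neq) = flip x , trans (parity-flip x) (p≢q⇒p⁻¹≡q _ π neq)

  adj : ∀ x y → hamming x y ≡ k * 2 → ∀ p q → hamming (proj₁ (normalise x p)) (proj₁ (normalise y q)) ≡ k * 2
  adj x y xy (yes _)   (yes _)   = xy
  adj x y xy (no _)    (no _)    = trans (hamming-flip x y) xy
  adj x y xy (yes x≡π) (no y≢π)  = contradiction (trans (sym (hamming-even⇒parity-≡ {k = k} x y xy)) x≡π) y≢π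
  adj x y xy (no x≢π)  (yes y≡π) = contradiction (trans (hamming-even⇒parity-≡ {k = k} x y xy) y≡π) x≢π

-- Colouring the layers of the cube

Layers : ℕ → ℕ → (ℕ → Set) → Graph
Layers n d P = Induced (Qexact n d) (P ∘ ∣_∣)

Colayers : ℕ → ℕ → (ℕ → Set) → Graph
Colayers n d P = Induced (Qexact n d) (P ∘ ∣_∣ ∘ ∁)

Colayers⟶Layers : ∀ {d} (P : ℕ → Set) → Colayers n d P ⟶ Layers n d P
Colayers⟶Layers P = hom (λ (x , p) → ∁ x , p) λ (x , _) (y , _) xy → trans (hamming-∁ x y) xy

double-injective : a * 2 ≡ b * 2 → a ≡ b
double-injective {a} {b} = *-cancelʳ-≡ a b 2

m+m≡m*2 : ∀ m → m + m ≡ m * 2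
m+m≡m*2 = solve-∀

-- `hamming-∩` reads 2k + 2|x ∩ y| = 2a here; the form `i + k ≡ a` avoids truncated subtraction.
layer⟶Johnson : i + k ≡ a → Layers n (k * 2) (_≡ a) ⟶ Johnson n a i
layer⟶Johnson {i} {k} {a} i+k≡a = hom id λ (x , x≡a) (y , y≡a) xy →
  +-cancelʳ-≡ k _ i (double-injective (begin
    (∣ x ∩ y ∣ + k) * 2          ≡⟨ *-distribʳ-+ 2 ∣ x ∩ y ∣ k ⟩
    ∣ x ∩ y ∣ * 2 + k * 2        ≡⟨ +-comm _ (k * 2) ⟩
    k * 2 + ∣ x ∩ y ∣ * 2        ≡⟨ cong (_+ ∣ x ∩ y ∣ * 2) (sym xy) ⟩
    hamming x y + ∣ x ∩ y ∣ * 2  ≡⟨ hamming-∩ x y ⟩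
    ∣ x ∣ + ∣ y ∣                ≡⟨ cong₂ _+_ x≡a y≡a ⟩
    a + a                        ≡⟨ m+m≡m*2 a ⟩
    a * 2                        ≡⟨ cong (_* 2) (sym i+k≡a) ⟩
    (i + k) * 2                  ∎))
  where open ≡-Reasoning

hamming≤ : (x y : Vec Bool n) → hamming x y ≤ ∣ x ∣ + ∣ y ∣
hamming≤ x y = subst (hamming x y ≤_) (hamming-∩ x y) (m≤m+n (hamming x y) _)

light-nonadjacent : ∀ k (x y : Vec Bool n) → ∣ x ∣ + ∣ y ∣ < k + k → ¬ hamming x y ≡ k * 2
light-nonadjacent k x y lt xy = <-irrefl (trans xy (sym (m+m≡m*2 k))) (≤-<-trans (hamming≤ x y) lt)

<-layers-edgeless : ∀ u v → ¬ Adj (Layers n (k * 2) (_< k)) u v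
<-layers-edgeless {k = k} (x , x<k) (y , y<k) = light-nonadjacent k x y (+-mono-< x<k y<k)

initial : k ≤ n → KSubset n k
initial {n = zero}  z≤n = [] , refl
initial {n = suc n} z≤n with initial {n = n} z≤n
... | x , eq = false ∷ x , eq
initial (s≤s k≤n) with initial k≤n
... | x , eq = true ∷ x , cong suc eq

-- Adjacency needs weights summing to at least 2k, so vertices of weight below k are isolated here
-- and may all go to the arbitrary set `initial k≤n`.
≤-layers⟶layer : k ≤ n → Layers n (k * 2) (_≤ k) ⟶ Layers n (k * 2) (_≡ k)
≤-layers⟶layer {k} {n} k≤n = hom (λ (x , _) → top x (∣ x ∣ ≟ k))
  λ (x , x≤k) (y , y≤k) xy → adj x y xy x≤k y≤k (∣ x ∣ ≟ k) (∣ y ∣ ≟ k)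
  where
  top : (x : Vec Bool n) → Dec (∣ x ∣ ≡ k) → KSubset n k
  top x (yes eq) = x , eq
  top x (no _)   = initial k≤n

  adj : ∀ x y → hamming x y ≡ k * 2 → ∣ x ∣ ≤ k → ∣ y ∣ ≤ k → ∀ p q →
    hamming (proj₁ (top x p)) (proj₁ (top y q)) ≡ k * 2
  adj x y xy x≤k y≤k (yes _)  (yes _)  = xy
  adj x y xy x≤k y≤k (no x≢k) _        = contradiction xy (light-nonadjacent k x y (+-mono-<-≤ (≤∧≢⇒< x≤k x≢k) y≤k))
  adj x y xy x≤k y≤k _        (no y≢k) = contradiction xy (light-nonadjacent k x y (+-mono-≤-< x≤k (≤∧≢⇒< y≤k y≢k)))

-- Writing w as e + k lets the weight lemmas below match on the surplus e.
<-or-+ : ∀ k w → w < k ⊎ Σ ℕ λ e → w ≡ e + k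
<-or-+ k w with k ≤? w
... | yes k≤w = inj₂ (w ∸ k , sym (m∸n+n≡m k≤w))
... | no k≰w  = inj₁ (≰⇒> k≰w)

coweight : ∀ e w′ → e + k + w′ ≡ 4 + k * 2 → e + w′ ≡ 4 + k
coweight {k} e w′ eq = +-cancelʳ-≡ k _ _ (trans (swap e k w′) (trans eq (double k)))
  where
  swap : ∀ e k w′ → e + w′ + k ≡ e + k + w′
  swap = solve-∀
  double : ∀ k → 4 + k * 2 ≡ 4 + k + k
  double = solve-∀

-- Parity excludes the surpluses 1 and 3; a surplus of at least 4 leaves the complement weight at
-- most k, as the two weights sum to 2k + 4.
parity-k-weights : ∀ {w w′} → w + w′ ≡ 4 + k * 2 → parity w ≡ parity k →
  (w ≤ k ⊎ w′ ≤ k) ⊎ w ≡ 2 + k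
parity-k-weights {k} {w} {w′} sum par with <-or-+ k w
... | inj₁ w<k        = inj₁ (inj₁ (<⇒≤ w<k))
... | inj₂ (0 , refl) = inj₁ (inj₁ ≤-refl)
... | inj₂ (1 , refl) = contradiction par (parity-suc-≢ k)
... | inj₂ (2 , refl) = inj₂ refl
-- `parity` recurses by steps of two, so `par` reduces to the same claim as for surplus 1.
... | inj₂ (3 , refl) = contradiction par (parity-suc-≢ k)
... | inj₂ (suc (suc (suc (suc e))) , refl) =
  inj₁ (inj₂ (m+n≤o⇒n≤o e (≤-reflexive (+-cancelˡ-≡ 4 _ _ (coweight (4 + e) w′ sum)))))

parity-1+k-weights : ∀ {w w′} → w + w′ ≡ 4 + k * 2 → parity w ≡ parity (suc k) →
  (w < k ⊎ w ≡ 1 + k) ⊎ (w′ < k ⊎ w′ ≡ 1 + k)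
parity-1+k-weights {k} {w} {w′} sum par with <-or-+ k w
... | inj₁ w<k        = inj₁ (inj₁ w<k)
... | inj₂ (0 , refl) = contradiction (sym par) (parity-suc-≢ k)
... | inj₂ (1 , refl) = inj₁ (inj₂ refl)
... | inj₂ (2 , refl) = contradiction (sym par) (parity-suc-≢ k)
... | inj₂ (3 , refl) = inj₂ (inj₂ (+-cancelˡ-≡ 3 _ _ (coweight 3 w′ sum)))
... | inj₂ (4 , refl) = contradiction (sym par) (parity-suc-≢ k)
... | inj₂ (suc (suc (suc (suc (suc e)))) , refl) =
  inj₂ (inj₁ (m+n≤o⇒n≤o e (≤-reflexive
    (trans (+-suc e w′) (+-cancelˡ-≡ 4 (suc (e + w′)) k (coweight (5 + e) w′ sum))))))

Qexact-colorable-parity-k : Colorable (Johnson (4 + k * 2) k 0) a →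
  Colorable (Johnson (4 + k * 2) (2 + k) 2) b →
  Colorable (Qexact (4 + k * 2) (k * 2)) (a + a + b)
Qexact-colorable-parity-k {k} {a} low mid =
  pullback (Qexact-parity {k = k} (parity k))
    (colorable-∪ {P = λ x → ∣ x ∣ ≤ k ⊎ ∣ ∁ x ∣ ≤ k}
      (λ x → parity-k-weights (∣p∣+∣∁p∣≡n x))
      (colorable-∪ (λ _ → id) low≤ (pullback (Colayers⟶Layers (_≤ k)) low≤))
      (pullback (layer⟶Johnson {i = 2} {k = k} refl) mid))
  where
  k≤n : k ≤ 4 + k * 2
  k≤n = ≤-trans (m≤m*n k 2) (m≤n+m (k * 2) 4)

  low≤ : Colorable (Layers (4 + k * 2) (k * 2) (_≤ k)) a
  low≤ = pullback (layer⟶Johnson {k = k} refl ⊚ ≤-layers⟶layer k≤n) low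

-- Each half spends a separate colour on the weights below k, since a (k - 1)-set is adjacent to
-- every (k + 1)-set disjoint from it.
Qexact-colorable-parity-1+k : Colorable (Johnson (4 + k * 2) (1 + k) 1) c →
  Colorable (Qexact (4 + k * 2) (k * 2)) ((1 + c) + (1 + c))
Qexact-colorable-parity-1+k {k} {c} layer =
  pullback (Qexact-parity {k = k} (parity (1 + k)))
    (colorable-∪ (λ x → parity-1+k-weights (∣p∣+∣∁p∣≡n x)) low (pullback (Colayers⟶Layers Low) low))
  where
  Low : ℕ → Set
  Low w = w < k ⊎ w ≡ 1 + k

  low : Colorable (Layers (4 + k * 2) (k * 2) Low) (1 + c)
  low = colorable-∪ (λ _ → id) (colorable-edgeless (<-layers-edgeless {k = k}))
    (pullback (layer⟶Johnson {i = 1} {k = k} refl) layer)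

-- Stahl's homomorphism for generalized Kneser graphs

∣x∩y∣<∣x∣⇒x≢y : (x y : Subset n) → ∣ x ∩ y ∣ < ∣ x ∣ → ¬ x ≡ y
∣x∩y∣<∣x∣⇒x≢y x .x lt refl = <-irrefl (cong ∣_∣ (∩-idem x)) lt

Johnson⟶Kneser : i < k → Johnson n k i ⟶ Kneser n k i
Johnson⟶Kneser i<k = hom id λ (x , x≡k) (y , _) xy →
  ∣x∩y∣<∣x∣⇒x≢y x y (subst₂ _<_ (sym xy) (sym x≡k) i<k) , ≤-reflexive xy

-- The head stands for the largest element, so this inserts the largest missing one; `drop` removes
-- the largest one present.
fill : Subset n → Subset n
fill []          = []
fill (false ∷ x) = true ∷ x
fill (true ∷ x)  = true ∷ fill x

drop : Subset n → Subset n
drop []          = []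
drop (true ∷ x)  = false ∷ x
drop (false ∷ x) = false ∷ drop x

∣fill∣ : (x : Subset n) → ∣ x ∣ < n → ∣ fill x ∣ ≡ suc ∣ x ∣
∣fill∣ (false ∷ x) _  = refl
∣fill∣ (true ∷ x)  lt = cong suc (∣fill∣ x (s≤s⁻¹ lt))

∣drop∣ : (x : Subset n) → 0 < ∣ x ∣ → suc ∣ drop x ∣ ≡ ∣ x ∣
∣drop∣ (true ∷ x)  _  = refl
∣drop∣ (false ∷ x) lt = ∣drop∣ x lt

∩-drop : (x y : Subset n) → ∣ x ∩ drop y ∣ ≤ ∣ x ∩ y ∣
∩-drop []          []          = z≤n
∩-drop (true ∷ x)  (true ∷ y)  = n≤1+n _
∩-drop (false ∷ x) (true ∷ y)  = ≤-refl
∩-drop (true ∷ x)  (false ∷ y) = ∩-drop x y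
∩-drop (false ∷ x) (false ∷ y) = ∩-drop x y

drop-∩ : (x y : Subset n) → ∣ drop x ∩ y ∣ ≤ ∣ x ∩ y ∣
drop-∩ x y = subst₂ (λ p q → ∣ p ∣ ≤ ∣ q ∣) (∩-comm y (drop x)) (∩-comm y x) (∩-drop y x)

fill-∩ : (x y : Subset n) → ∣ fill x ∩ y ∣ ≤ suc ∣ x ∩ y ∣
fill-∩ []          []          = z≤n
fill-∩ (true ∷ x)  (true ∷ y)  = s≤s (fill-∩ x y)
fill-∩ (true ∷ x)  (false ∷ y) = fill-∩ x y
fill-∩ (false ∷ x) (true ∷ y)  = ≤-refl
fill-∩ (false ∷ x) (false ∷ y) = n≤1+n _

∩-fill : (x y : Subset n) → ∣ x ∩ fill y ∣ ≤ suc ∣ x ∩ y ∣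
∩-fill x y = subst₂ (λ p q → ∣ p ∣ ≤ suc ∣ q ∣) (∩-comm (fill y) x) (∩-comm y x) (fill-∩ y x)

-- If the element z inserted into x lies in `drop y`, then max y > z belongs to x, as everything
-- above z does, and removing it from y loses a common element.
fill-∩-drop : (x y : Subset n) → ∣ fill x ∩ drop y ∣ ≤ ∣ x ∩ y ∣
fill-∩-drop []          []          = z≤n
fill-∩-drop (true ∷ x)  (true ∷ y)  = fill-∩ x y
fill-∩-drop (true ∷ x)  (false ∷ y) = fill-∩-drop x y
fill-∩-drop (false ∷ x) (true ∷ y)  = ≤-refl
fill-∩-drop (false ∷ x) (false ∷ y) = ∩-drop x y

-- Reading vectors from the largest element down, this removes the maximum,
-- except that {n + 1, n + 2} ⊆ x is traded for the largest missing element z.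
-- Intersections cannot grow: if z survives in the image of y, then max y > z,
-- so the element removed from y was a common element.
stahl : Subset (2 + n) → Subset n
stahl (true ∷ true ∷ x)   = fill x
stahl (true ∷ false ∷ x)  = x
stahl (false ∷ true ∷ x)  = x
stahl (false ∷ false ∷ x) = drop x

∣stahl∣ : (x : Subset (2 + n)) → 0 < k → k ≤ n → ∣ x ∣ ≡ suc k → ∣ stahl x ∣ ≡ k
∣stahl∣ (true ∷ true ∷ x) _ k≤n eq =
  trans (∣fill∣ x (≤-trans (≤-reflexive (suc-injective eq)) k≤n)) (suc-injective eq)
∣stahl∣ (true ∷ false ∷ x)  _ _ eq = suc-injective eq
∣stahl∣ (false ∷ true ∷ x)  _ _ eq = suc-injective eq
∣stahl∣ (false ∷ false ∷ x) _ _ eq = suc-injective (trans (∣drop∣ x (subst (0 <_) (sym eq) (s≤s z≤n))) eq)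

stahl-∩ : (x y : Subset (2 + n)) → ∣ stahl x ∩ stahl y ∣ ≤ ∣ x ∩ y ∣
-- Losing the two common leading elements pays for the two insertions.
stahl-∩ (true ∷ true ∷ x)   (true ∷ true ∷ y)   = ≤-trans (fill-∩ x (fill y)) (s≤s (∩-fill x y))
stahl-∩ (true ∷ true ∷ x)   (true ∷ false ∷ y)  = fill-∩ x y
stahl-∩ (true ∷ true ∷ x)   (false ∷ true ∷ y)  = fill-∩ x y
stahl-∩ (true ∷ true ∷ x)   (false ∷ false ∷ y) = fill-∩-drop x y
stahl-∩ (true ∷ false ∷ x)  (true ∷ true ∷ y)   = ∩-fill x y
stahl-∩ (true ∷ false ∷ x)  (true ∷ false ∷ y)  = n≤1+n _
stahl-∩ (true ∷ false ∷ x)  (false ∷ true ∷ y)  = ≤-refl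
stahl-∩ (true ∷ false ∷ x)  (false ∷ false ∷ y) = ∩-drop x y
stahl-∩ (false ∷ true ∷ x)  (true ∷ true ∷ y)   = ∩-fill x y
stahl-∩ (false ∷ true ∷ x)  (true ∷ false ∷ y)  = ≤-refl
stahl-∩ (false ∷ true ∷ x)  (false ∷ true ∷ y)  = n≤1+n _
stahl-∩ (false ∷ true ∷ x)  (false ∷ false ∷ y) = ∩-drop x y
stahl-∩ (false ∷ false ∷ x) (false ∷ false ∷ y) = ≤-trans (∩-drop (drop x) y) (drop-∩ x y)
stahl-∩ (false ∷ false ∷ x) (true ∷ false ∷ y)  = drop-∩ x y
stahl-∩ (false ∷ false ∷ x) (false ∷ true ∷ y)  = drop-∩ x y
stahl-∩ (false ∷ false ∷ x) (true ∷ true ∷ y)   =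
  subst₂ (λ p q → ∣ p ∣ ≤ ∣ q ∣) (∩-comm (fill y) (drop x)) (∩-comm y x) (fill-∩-drop y x)

-- Images stay distinct because they have k elements but share at most i < k.
Kneser-stahl : i < k → k ≤ n → Kneser (2 + n) (suc k) i ⟶ Kneser n k i
Kneser-stahl {i} {k} {n} i<k k≤n = hom (λ (x , eq) → stahl x , card x eq)
  λ (x , eq) (y , _) (_ , x∩y≤i) →
    let small = ≤-trans (stahl-∩ x y) x∩y≤i in
    ∣x∩y∣<∣x∣⇒x≢y (stahl x) (stahl y)
      (<-≤-trans (≤-<-trans small i<k) (≤-reflexive (sym (card x eq)))) , small
  where
  card : (x : Subset (2 + n)) → ∣ x ∣ ≡ suc k → ∣ stahl x ∣ ≡ k
  card x = ∣stahl∣ x (≤-<-trans z≤n i<k) k≤n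

Kneser-stahl* : ∀ j → Kneser (4 + (2 + j) * 2) (3 + j) 1 ⟶ Kneser 8 3 1
Kneser-stahl* zero    = hom id λ _ _ → id
Kneser-stahl* (suc j) = Kneser-stahl* j ⊚ Kneser-stahl (s≤s (s≤s z≤n))
  (+-mono-≤ (m≤m+n 3 5) (m≤m*n j 2))

-- The case n = 6: the Fano plane

allVec? : {P : Vec Bool n → Set} → Decidable P → Dec (∀ x → P x)
allVec? {zero}  P? = map′ (λ { p [] → p }) (λ p → p []) (P? [])
allVec? {suc n} P? = map′
  (λ { (p , q) (true ∷ x) → p x ; (p , q) (false ∷ x) → q x })
  (λ p → (λ x → p (true ∷ x)) , (λ x → p (false ∷ x)))
  (allVec? (P? ∘ (true ∷_)) ×-dec allVec? (P? ∘ (false ∷_)))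

-- The six points are labelled by the vectors 001, …, 110 of F₂³, an edge is
-- coloured by the sum s ≠ 0 of its ends, and the colour s is sent to the line
-- {t ≠ 0 : ⟨s , t⟩ = 0}.
fano : Subset 6 → Subset 8
fano (x₁ ∷ x₂ ∷ x₃ ∷ x₄ ∷ x₅ ∷ x₆ ∷ []) =
  false ∷ map not (r ∷ s ∷ (s xor r) ∷ t ∷ (t xor r) ∷ (t xor s) ∷ (t xor s xor r) ∷ [])
  where
  r = x₁ xor x₃ xor x₅
  s = x₂ xor x₃ xor x₆
  t = x₄ xor x₅ xor x₆

-- Distinct labels have a nonzero sum, and every Fano line has three points.
∣fano∣ : ∀ x → ∣ x ∣ ≡ 2 → ∣ fano x ∣ ≡ 3
∣fano∣ = from-yes (allVec? λ x → (∣ x ∣ ≟ 2) →-dec (∣ fano x ∣ ≟ 3))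

-- Edges sharing one end have different sums, and distinct Fano lines meet in one point. Testing |x|
-- = 2 before quantifying over y shortens the exhaustive check.
fano-∩ : ∀ x → ∣ x ∣ ≡ 2 → ∀ y → ∣ y ∣ ≡ 2 → ∣ x ∩ y ∣ ≡ 1 → ∣ fano x ∩ fano y ∣ ≤ 1
fano-∩ = from-yes (allVec? λ x → (∣ x ∣ ≟ 2) →-dec allVec? λ y → (∣ y ∣ ≟ 2) →-dec
  (∣ x ∩ y ∣ ≟ 1) →-dec (∣ fano x ∩ fano y ∣ ≤? 1))

Johnson-6-2-1⟶Kneser-8-3-1 : Johnson 6 2 1 ⟶ Kneser 8 3 1
Johnson-6-2-1⟶Kneser-8-3-1 = hom (λ (x , eq) → fano x , ∣fano∣ x eq)
  λ (x , x≡2) (y , y≡2) xy →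
    let small = fano-∩ x x≡2 y y≡2 xy in
    ∣x∩y∣<∣x∣⇒x≢y (fano x) (fano y)
      (≤-trans (s≤s small) (≤-trans (n≤1+n 2) (≤-reflexive (sym (∣fano∣ x x≡2))))) , small

-- The case n = 6 has its own map because Stahl's goes the other way, from K(8, 3, 1) to K(6, 2, 1).
Johnson⟶Kneser-8-3-1 : ∀ j → Johnson (4 + (1 + j) * 2) (2 + j) 1 ⟶ Kneser 8 3 1
Johnson⟶Kneser-8-3-1 zero    = Johnson-6-2-1⟶Kneser-8-3-1
Johnson⟶Kneser-8-3-1 (suc j) = Kneser-stahl* j ⊚ Johnson⟶Kneser (s≤s (s≤s z≤n))

-- Combining the bounds

chromatic-bounds : ∀ j q a b c e → let n = 4 + (1 + j) * 2 in
  IsChromaticNumber (Qexact n ((1 + j) * 2)) q →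
  IsChromaticNumber (Johnson n (1 + j) 0) a →
  IsChromaticNumber (Johnson n (3 + j) 2) b →
  IsChromaticNumber (Johnson n (2 + j) 1) c →
  IsChromaticNumber (Kneser 8 3 1) e →
  (q ≤ (2 * a + b) ⊓ (2 * c + 2)) × ((2 * a + b) ⊓ (2 * c + 2) ≤ 2 * e + 2)
chromatic-bounds j q a b c e (_ , q-min) (colₐ , _) (col_b , _) (col_c , c-min) (colₑ , _) =
  ⊓-glb (subst (q ≤_) (2a+b a b) (q-min _ (Qexact-colorable-parity-k {k = 1 + j} colₐ col_b)))
        (subst (q ≤_) (2c+2 c) (q-min _ (Qexact-colorable-parity-1+k {k = 1 + j} col_c))) ,
  ≤-trans (m⊓n≤n (2 * a + b) (2 * c + 2)) (+-monoˡ-≤ 2 (*-monoʳ-≤ 2 c≤e))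
  where
  2a+b : ∀ a b → a + a + b ≡ 2 * a + b
  2a+b = solve-∀
  2c+2 : ∀ c → (1 + c) + (1 + c) ≡ 2 * c + 2
  2c+2 = solve-∀
  c≤e : c ≤ e
  c≤e = c-min e (pullback (Johnson⟶Kneser-8-3-1 j) colₑ)

theorem4p19 : ∀ (n : ℕ) → 6 ≤ n → n % 2 ≡ 0 →
    ∀ (q a b c e : ℕ) →
    IsChromaticNumber (Qexact n (n ∸ 4)) q →
    IsChromaticNumber (Johnson n ((n ∸ 4) / 2) 0) a →
    IsChromaticNumber (Johnson n (n / 2) 2) b →
    IsChromaticNumber (Johnson n ((n ∸ 2) / 2) 1) c →
    IsChromaticNumber (Kneser 8 3 1) e →
    (q ≤ (2 * a + b) ⊓ (2 * c + 2)) × ((2 * a + b) ⊓ (2 * c + 2) ≤ 2 * e + 2)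
theorem4p19 n 6≤n n%2≡0 q a b c e χQ χA χB χC χE with m%n≡0⇒n∣m n 2 n%2≡0
theorem4p19 _ (s≤s (s≤s (s≤s (s≤s ())))) _ q a b c e χQ χA χB χC χE | divides-refl 2
-- Here n = (3 + j) * 2, so k = 1 + j and the three halved subset sizes are 1 + j, 3 + j and 2 + j.
theorem4p19 _ _ _ q a b c e χQ χA χB χC χE | divides-refl (suc (suc (suc j))) =
  chromatic-bounds j q a b c e χQ
    (subst (λ h → IsChromaticNumber (Johnson ((3 + j) * 2) h 0) a) (m*n/n≡m (1 + j) 2) χA)
    (subst (λ h → IsChromaticNumber (Johnson ((3 + j) * 2) h 2) b) (m*n/n≡m (3 + j) 2) χB)
    (subst (λ h → IsChromaticNumber (Johnson ((3 + j) * 2) h 1) c) (m*n/n≡m (2 + j) 2) χC)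
    χE
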